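{- Consider positions of Version C in which all piles have at most $3$ tokens, with $a_1$ piles of size $1$, $a_2$ piles of size $2$, and $a_3$ piles of size $3$. Such a position is a $\mathcal{P}$-position if and only if at least one of the following holds: \begin{itemize} \item $a_1=0$ and $a_3=0$; \item $(a_1,a_2,a_3)\in\{(0,1,3),(0,2,3),(1,0,2),(1,0,5),(2,0,1)\}$; \item $a_1+2a_2\equiv 0 \pmod 3$ and $(a_1,a_2,a_3)$ is not one of the following exceptions: \begin{itemize} \item $(0,3k,j)$ with $k\geq 0$ an integer and $j\in\{1,2\}$; \item $(1,3k+1,j)$ with $k\geq 0$ an integer and $j\in\{0,1\}$; \item $(2,3k+2,0)$ with $k\geq 0$ an integer; \item $(0,0,4)$, $(0,0,5)$, $(1,1,2)$, $(1,1,3)$, $(1,1,4)$, $(1,1,5)$, $(2,2,3)$, $(3,0,1)$, $(3,0,2)$, $(3,0,5)$. \end{itemize} \end{itemize}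
   Context: Version C is a two-player impartial game. A position consists of finitely many piles of tokens. The players alternate turns; on a turn, a player either removes a single token from any one nonempty pile, or selects two different nonempty piles and removes one token from each of those two. The last player to move wins. A position is a $\mathcal{P}$-position if the player who is not about to move has a winning strategy, equivalently if none of its options (positions reachable in one move) is a $\mathcal{P}$-position; otherwise it is an $\mathcal{N}$-position. Here $a_1,a_2,a_3$ are nonnegative integers. -}

module Defs where

open import Data.List using (List; []; _∷_; filter; length)
open import Data.List.Membership.Propositional using (_∈_)
open import Data.Nat using (ℕ; suc; _+_; _*_; _%_; _≟_)
open import Data.Product using (_×_; _,_; ∃; ∃₂)
open import Data.Sum using (_⊎_)
open import Relation.Binary.PropositionalEquality using (_≡_)
open import Relation.Nullary using (¬_)

-- The list of pile sizes.  An emptied pile stays in the list as a 0, which no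
-- move can touch.
Position : Set
Position = List ℕ

data TakeOne : Position → Position → Set where
  here  : ∀ {x xs} → TakeOne (suc x ∷ xs) (x ∷ xs)
  there : ∀ {x xs ys} → TakeOne xs ys → TakeOne (x ∷ xs) (x ∷ ys)

-- One token from each of two different piles: `here` uses the first pile, and
-- the other one is then chosen among the remaining piles.
data TakeTwo : Position → Position → Set where
  here  : ∀ {x xs ys} → TakeOne xs ys → TakeTwo (suc x ∷ xs) (x ∷ ys)
  there : ∀ {x xs ys} → TakeTwo xs ys → TakeTwo (x ∷ xs) (x ∷ ys)

Move : Position → Position → Set
Move p q = TakeOne p q ⊎ TakeTwo p q

-- A derivation of `IsP p` (resp. `IsN p`) is a winning strategy for the player
-- who is not (resp. is) about to move; a player unable to move has lost.
mutual
  data IsP (p : Position) : Set where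
    isP : (∀ q → Move p q → IsN q) → IsP p

  data IsN (p : Position) : Set where
    isN : ∀ q → Move p q → IsP q → IsN p

#piles : ℕ → Position → ℕ
#piles s p = length (filter (_≟ s) p)

Triple : Set
Triple = ℕ × ℕ × ℕ

SporadicP : List Triple
SporadicP =
  (0 , 1 , 3) ∷ (0 , 2 , 3) ∷ (1 , 0 , 2) ∷ (1 , 0 , 5) ∷ (2 , 0 , 1) ∷ []

SporadicException : List Triple
SporadicException =
  (0 , 0 , 4) ∷ (0 , 0 , 5) ∷ (1 , 1 , 2) ∷ (1 , 1 , 3) ∷ (1 , 1 , 4) ∷
  (1 , 1 , 5) ∷ (2 , 2 , 3) ∷ (3 , 0 , 1) ∷ (3 , 0 , 2) ∷ (3 , 0 , 5) ∷ []

Exception : Triple → Set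
Exception t =
    (∃₂ λ k j → j ∈ 1 ∷ 2 ∷ [] × t ≡ (0 , 3 * k , j))
  ⊎ (∃₂ λ k j → j ∈ 0 ∷ 1 ∷ [] × t ≡ (1 , 3 * k + 1 , j))
  ⊎ (∃ λ k → t ≡ (2 , 3 * k + 2 , 0))
  ⊎ t ∈ SporadicException

PCondition : ℕ → ℕ → ℕ → Set
PCondition a₁ a₂ a₃ =
    (a₁ ≡ 0 × a₃ ≡ 0)
  ⊎ (a₁ , a₂ , a₃) ∈ SporadicP
  ⊎ ((a₁ + 2 * a₂) % 3 ≡ 0 × ¬ Exception (a₁ , a₂ , a₃))

{-# OPTIONS --safe #-}
-- Whether a position is a 𝒫-position depends only on its census (a₁, a₂, a₃).
-- The claimed set of censuses is the set of 𝒫-positions once, for every census,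
-- it belongs to the set exactly when none of its options does.  Both sides of
-- this equivalence are eventually periodic in each coordinate, with period 3, 3
-- and 1, so finitely many censuses need to be examined, which is done by
-- evaluation.
module Submission where

open import Defs
open import Data.Bool using (not)
import Data.Bool.Properties as Bool
open import Data.Fin using (Fin; zero; suc; toℕ; fromℕ<)
open import Data.Fin.Properties using (any?; toℕ-fromℕ<)
open import Data.List using ([]; _∷_; _++_; filter; length)
open import Data.List.Membership.Propositional using (_∈_)
open import Data.List.Membership.Propositional.Properties using (∈-∃++; ∈-filter⁻)
open import Data.List.Relation.Binary.Permutation.Propositional
open import Data.List.Relation.Binary.Permutation.Propositional.Properties
  using (All-resp-↭; filter-↭; shift; ↭-length)
open import Data.List.Relation.Unary.All using (All; []; _∷_)
import Data.List.Relation.Unary.Any as Any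
open import Data.Nat
open import Data.Nat.DivMod
  using (m≡m%n+[m/n]*n; [m+kn]%n≡m%n; m<n⇒m%n≡m; %-distribˡ-+; %-distribˡ-*)
open import Data.Nat.Induction using (Acc; acc; <-rec; <-wellFounded)
open import Data.Nat.ListAction using (sum)
open import Data.Nat.Properties
open import Data.Product using (_×_; _,_; ∃; ∃₂; proj₁; proj₂)
open import Data.Sum using (_⊎_; inj₁; inj₂)
open import Function using (_∘_; const)
open import Function.Bundles using (_⇔_; mk⇔; module Equivalence)
open import Level using (0ℓ)
open import Relation.Binary.Definitions using (DecidableEquality)
open import Relation.Binary.PropositionalEquality
  using (_≡_; refl; sym; cong; cong₂; subst; module ≡-Reasoning)
  renaming (trans to ≡-trans)
open import Relation.Nullary
open import Relation.Nullary.Decidable using (decidable-stable; map′; toWitness)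
open import Relation.Unary using (Pred; Decidable)

-- Census of a position

census : Position → Triple
census p = #piles 1 p , #piles 2 p , #piles 3 p

-- An emptied pile is not counted, so `bump 0` is the identity and lowering a pile of size 1 needs
-- no separate case.
bump : ℕ → Triple → Triple
bump 1 (a , b , c) = suc a , b , c
bump 2 (a , b , c) = a , suc b , c
bump 3 (a , b , c) = a , b , suc c
bump _ t           = t

census-∷ : ∀ x p → census (x ∷ p) ≡ bump x (census p)
census-∷ 0 p = refl
census-∷ 1 p = refl
census-∷ 2 p = refl
census-∷ 3 p = refl
census-∷ (suc (suc (suc (suc x)))) p = refl

#piles-↭ : ∀ s {p q} → p ↭ q → #piles s p ≡ #piles s q
#piles-↭ s p↭q = ↭-length (filter-↭ (_≟ s) p↭q)

census-↭ : ∀ {p q} → p ↭ q → census p ≡ census q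
census-↭ p↭q =
  cong₂ _,_ (#piles-↭ 1 p↭q) (cong₂ _,_ (#piles-↭ 2 p↭q) (#piles-↭ 3 p↭q))

filter-nonempty : ∀ {A : Set} {P : Pred A 0ℓ} (P? : Decidable P) xs {n} →
  length (filter P? xs) ≡ suc n → ∃ λ x → x ∈ xs × P x
filter-nonempty P? xs eq with filter P? xs in f
... | x ∷ _ = x , ∈-filter⁻ P? (subst (x ∈_) (sym f) (Any.here refl))

remove-pile : ∀ s p {n} → #piles s p ≡ suc n → ∃ λ r → p ↭ s ∷ r
remove-pile s p eq with _ , s∈p , refl ← filter-nonempty (_≟ s) p eq
                   with ys , zs , refl ← ∈-∃++ s∈p = ys ++ zs , shift s ys zs

bump-injective : ∀ (s : Fin 3) {t u} → bump (suc (toℕ s)) t ≡ bump (suc (toℕ s)) u → t ≡ u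
bump-injective zero             refl = refl
bump-injective (suc zero)       refl = refl
bump-injective (suc (suc zero)) refl = refl

bump-pile : ∀ (s : Fin 3) p {t} → census p ≡ bump (suc (toℕ s)) t →
  ∃ λ n → #piles (suc (toℕ s)) p ≡ suc n
bump-pile zero             p eq = _ , cong proj₁ eq
bump-pile (suc zero)       p eq = _ , cong (proj₁ ∘ proj₂) eq
bump-pile (suc (suc zero)) p eq = _ , cong (proj₂ ∘ proj₂) eq

-- Turns a splitting of the census into an actual pile: the count of that size is positive, and
-- injectivity of `bump` identifies the census of the rest.
census-bump : ∀ (s : Fin 3) p {t} → census p ≡ bump (suc (toℕ s)) t →
  ∃ λ r → p ↭ suc (toℕ s) ∷ r × census r ≡ t
census-bump s p {t} eq
  with r , p↭ ← remove-pile (suc (toℕ s)) p (proj₂ (bump-pile s p eq))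
  = r , p↭ , bump-injective s (begin
    bump (suc (toℕ s)) (census r) ≡⟨ census-∷ (suc (toℕ s)) r ⟨
    census (suc (toℕ s) ∷ r)      ≡⟨ census-↭ p↭ ⟨
    census p                      ≡⟨ eq ⟩
    bump (suc (toℕ s)) t          ∎)
  where open ≡-Reasoning

-- Moves up to the order of the piles

takeOne-split : ∀ {p q} → TakeOne p q → ∃₂ λ x r → p ↭ suc x ∷ r × q ↭ x ∷ r
takeOne-split here = _ , _ , ↭-refl , ↭-refl
takeOne-split (there {x} m) with _ , _ , p↭ , q↭ ← takeOne-split m =
  _ , _ , trans (prep x p↭) (swap _ _ ↭-refl) , trans (prep x q↭) (swap _ _ ↭-refl)

takeTwo-split : ∀ {p q} → TakeTwo p q →
  ∃₂ λ x y → ∃ λ r → p ↭ suc x ∷ suc y ∷ r × q ↭ x ∷ y ∷ r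
takeTwo-split (here m) with _ , _ , p↭ , q↭ ← takeOne-split m =
  _ , _ , _ , prep _ p↭ , prep _ q↭
takeTwo-split (there {x} m) with _ , _ , _ , p↭ , q↭ ← takeTwo-split m =
  _ , _ , _ , trans (prep x p↭) sink , trans (prep x q↭) sink
  where
  sink : ∀ {x y z : ℕ} {r} → x ∷ y ∷ z ∷ r ↭ y ∷ z ∷ x ∷ r
  sink = trans (swap _ _ ↭-refl) (prep _ (swap _ _ ↭-refl))

-- Lets a move be made with the chosen pile in front and then carried back to the given order of
-- piles.
takeOne-↭ : ∀ {p p′ q′} → p ↭ p′ → TakeOne p′ q′ → ∃ λ q → TakeOne p q × q ↭ q′
takeOne-↭ refl m = _ , m , ↭-refl
takeOne-↭ (prep x p↭) here = _ , here , prep _ p↭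
takeOne-↭ (prep x p↭) (there m) with _ , m′ , q↭ ← takeOne-↭ p↭ m =
  _ , there m′ , prep x q↭
takeOne-↭ (swap x y p↭) here = _ , there here , swap _ _ p↭
takeOne-↭ (swap x y p↭) (there here) = _ , here , swap _ _ p↭
takeOne-↭ (swap x y p↭) (there (there m)) with _ , m′ , q↭ ← takeOne-↭ p↭ m =
  _ , there (there m′) , swap x y q↭
takeOne-↭ (trans p↭ p′↭) m with _ , m′ , q′↭ ← takeOne-↭ p′↭ m
                           with _ , m″ , q↭ ← takeOne-↭ p↭ m′ = _ , m″ , trans q↭ q′↭

takeTwo-↭ : ∀ {p p′ q′} → p ↭ p′ → TakeTwo p′ q′ → ∃ λ q → TakeTwo p q × q ↭ q′
takeTwo-↭ refl m = _ , m , ↭-refl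
takeTwo-↭ (prep x p↭) (here m) with _ , m′ , q↭ ← takeOne-↭ p↭ m =
  _ , here m′ , prep _ q↭
takeTwo-↭ (prep x p↭) (there m) with _ , m′ , q↭ ← takeTwo-↭ p↭ m =
  _ , there m′ , prep x q↭
takeTwo-↭ (swap x y p↭) (here here) = _ , here here , swap _ _ p↭
takeTwo-↭ (swap x y p↭) (here (there m)) with _ , m′ , q↭ ← takeOne-↭ p↭ m =
  _ , there (here m′) , swap _ _ q↭
takeTwo-↭ (swap x y p↭) (there (here m)) with _ , m′ , q↭ ← takeOne-↭ p↭ m =
  _ , here (there m′) , swap _ _ q↭
takeTwo-↭ (swap x y p↭) (there (there m)) with _ , m′ , q↭ ← takeTwo-↭ p↭ m =
  _ , there (there m′) , swap x y q↭
takeTwo-↭ (trans p↭ p′↭) m with _ , m′ , q′↭ ← takeTwo-↭ p′↭ m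
                           with _ , m″ , q↭ ← takeTwo-↭ p↭ m′ = _ , m″ , trans q↭ q′↭

takeOne-sum : ∀ {p q} → TakeOne p q → sum q < sum p
takeOne-sum here          = ≤-refl
takeOne-sum (there {x} m) = +-monoʳ-< x (takeOne-sum m)

takeTwo-sum : ∀ {p q} → TakeTwo p q → sum q < sum p
takeTwo-sum (here {x} m)  = m<n⇒m<1+n (+-monoʳ-< x (takeOne-sum m))
takeTwo-sum (there {x} m) = +-monoʳ-< x (takeTwo-sum m)

move-sum : ∀ {p q} → Move p q → sum q < sum p
move-sum (inj₁ m) = takeOne-sum m
move-sum (inj₂ m) = takeTwo-sum m

takeOne-bounded : ∀ {k p q} → TakeOne p q → All (_≤ k) p → All (_≤ k) q
takeOne-bounded here      (px ∷ ps) = <⇒≤ px ∷ ps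
takeOne-bounded (there m) (px ∷ ps) = px ∷ takeOne-bounded m ps

takeTwo-bounded : ∀ {k p q} → TakeTwo p q → All (_≤ k) p → All (_≤ k) q
takeTwo-bounded (here m)  (px ∷ ps) = <⇒≤ px ∷ takeOne-bounded m ps
takeTwo-bounded (there m) (px ∷ ps) = px ∷ takeTwo-bounded m ps

move-bounded : ∀ {k p q} → Move p q → All (_≤ k) p → All (_≤ k) q
move-bounded (inj₁ m) = takeOne-bounded m
move-bounded (inj₂ m) = takeTwo-bounded m

-- Options of a census

-- `HasPile s R t`: the census t has a pile of size s + 1, and R holds for the
-- census of the other piles.
HasPile : Fin 3 → Pred Triple 0ℓ → Pred Triple 0ℓ
HasPile s R t = ∃ λ u → t ≡ bump (suc (toℕ s)) u × R u

-- In the second summand the inner pile is sought in `u`, from which the outer pile is already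
-- removed, so the two piles differ even when their sizes agree.
OptionIn : Pred Triple 0ℓ → Pred Triple 0ℓ
OptionIn Q t =
    (∃ λ s → HasPile s (λ u → Q (bump (toℕ s) u)) t)
  ⊎ (∃ λ s → HasPile s (λ u →
      ∃ λ s′ → HasPile s′ (λ v → Q (bump (toℕ s) (bump (toℕ s′) v))) u) t)

census-↭∷ : ∀ {x p r} → p ↭ x ∷ r → census p ≡ bump x (census r)
census-↭∷ {x} {r = r} p↭ = ≡-trans (census-↭ p↭) (census-∷ x r)

census-↭∷∷ : ∀ {x y p r} → p ↭ x ∷ y ∷ r → census p ≡ bump x (bump y (census r))
census-↭∷∷ {x} {y} {r = r} p↭ = ≡-trans (census-↭∷ p↭) (cong (bump x) (census-∷ y r))

bounded-pile : ∀ {x} → suc x ≤ 3 → ∃ λ (s : Fin 3) → toℕ s ≡ x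
bounded-pile x<3 = fromℕ< x<3 , toℕ-fromℕ< x<3

-- The bound 3 lets each touched pile, whose size is a successor, be indexed by `Fin 3`.
move⇒optionIn : ∀ Q {p q} → All (_≤ 3) p → Move p q → Q (census q) → OptionIn Q (census p)
move⇒optionIn Q p≤3 (inj₁ m) Qq
  with x , r , p↭ , q↭ ← takeOne-split m
  with sx≤3 ∷ _ ← All-resp-↭ p↭ p≤3
  with s , refl ← bounded-pile sx≤3
  = inj₁ (s , census r , census-↭∷ p↭ , subst Q (census-↭∷ q↭) Qq)
move⇒optionIn Q p≤3 (inj₂ m) Qq
  with x , y , r , p↭ , q↭ ← takeTwo-split m
  with sx≤3 ∷ sy≤3 ∷ _ ← All-resp-↭ p↭ p≤3
  with s , refl ← bounded-pile sx≤3
  with s′ , refl ← bounded-pile sy≤3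
  = inj₂ (s , bump (suc (toℕ s′)) (census r) , census-↭∷∷ p↭
        , s′ , census r , refl
        , subst Q (census-↭∷∷ q↭) Qq)

optionIn⇒move : ∀ Q p → OptionIn Q (census p) → ∃ λ q → Move p q × Q (census q)
optionIn⇒move Q p (inj₁ (s , t , eq , Qt))
  with r , p↭ , refl ← census-bump s p eq
  with q , m , q↭ ← takeOne-↭ p↭ here
  = q , inj₁ m , subst Q (sym (census-↭∷ q↭)) Qt
optionIn⇒move Q p (inj₂ (s , t , eq , s′ , u , eq′ , Qu))
  with r , p↭ , refl ← census-bump s p eq
  with r′ , r↭ , refl ← census-bump s′ r eq′
  with q , m , q↭ ← takeTwo-↭ (trans p↭ (prep _ r↭)) (here here)
  = q , inj₂ m , subst Q (sym (census-↭∷∷ q↭)) Qu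

-- Decision procedures.  Their Boolean parts are built with `_∧_` and `_∨_`
-- rather than by case analysis, so that they are periodic in each coordinate by
-- mere computation, even when the other coordinates are variables.

isSuc? : ∀ {R : Pred ℕ 0ℓ} → Decidable R → Decidable (λ m → ∃ λ n → m ≡ suc n × R n)
isSuc? R? m = map′ (λ { (s≤s z≤n , r) → _ , refl , r })
                   (λ { (_ , refl , r) → s≤s z≤n , r })
                   -- `pred` avoids a case split on `m`; its value at 0 is harmless, since the first
                   -- conjunct is then false.
                   ((0 <? m) ×-dec R? (pred m))

hasPile? : ∀ s {R} → Decidable R → Decidable (HasPile s R)
hasPile? zero R? (a , b , c) =
  map′ (λ { (_ , refl , r) → _ , refl , r }) (λ { (_ , refl , r) → _ , refl , r })
       (isSuc? (λ n → R? (n , b , c)) a)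
hasPile? (suc zero) R? (a , b , c) =
  map′ (λ { (_ , refl , r) → _ , refl , r }) (λ { (_ , refl , r) → _ , refl , r })
       (isSuc? (λ n → R? (a , n , c)) b)
hasPile? (suc (suc zero)) R? (a , b , c) =
  map′ (λ { (_ , refl , r) → _ , refl , r }) (λ { (_ , refl , r) → _ , refl , r })
       (isSuc? (λ n → R? (a , b , n)) c)

optionIn? : ∀ {Q} → Decidable Q → Decidable (OptionIn Q)
optionIn? Q? t =
      any? (λ s → hasPile? s (λ u → Q? (bump (toℕ s) u)) t)
  ⊎-dec any? (λ s → hasPile? s (λ u →
          any? (λ s′ → hasPile? s′ (λ v → Q? (bump (toℕ s) (bump (toℕ s′) v))) u)) t)

_≟ₜ_ : DecidableEquality Triple
(a , b , c) ≟ₜ (a′ , b′ , c′) =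
  map′ (λ { (refl , refl , refl) → refl }) (λ { refl → refl , refl , refl })
       ((a ≟ a′) ×-dec (b ≟ b′) ×-dec (c ≟ c′))

-- Testing `b % 3` replaces a search for `k`, and `(3 + b) % 3` computes to `b % 3` even for a
-- variable `b`.
residue? : ∀ r → r < 3 → Decidable (λ b → ∃ λ k → b ≡ 3 * k + r)
residue? r r<3 b = map′ to from (b % 3 ≟ r)
  where
  open ≡-Reasoning
  to : b % 3 ≡ r → ∃ λ k → b ≡ 3 * k + r
  to eq = b / 3 , (begin
    b                 ≡⟨ m≡m%n+[m/n]*n b 3 ⟩
    b % 3 + b / 3 * 3 ≡⟨ cong₂ _+_ eq (*-comm (b / 3) 3) ⟩
    r + 3 * (b / 3)   ≡⟨ +-comm r (3 * (b / 3)) ⟩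
    3 * (b / 3) + r   ∎)
  from : (∃ λ k → b ≡ 3 * k + r) → b % 3 ≡ r
  from (k , refl) = begin
    (3 * k + r) % 3 ≡⟨ cong (_% 3) (+-comm (3 * k) r) ⟩
    (r + 3 * k) % 3 ≡⟨ cong (λ m → (r + m) % 3) (*-comm 3 k) ⟩
    (r + k * 3) % 3 ≡⟨ [m+kn]%n≡m%n r k 3 ⟩
    r % 3           ≡⟨ m<n⇒m%n≡m r<3 ⟩
    r               ∎

exception? : Decidable Exception
exception? t@(a , b , c) =
      map′ (λ { (refl , (k , refl) , j∈) →
             k , c , j∈ , cong (λ m → 0 , m , c) (+-identityʳ (3 * k)) })
           (λ { (k , j , j∈ , refl) → refl , (k , sym (+-identityʳ (3 * k))) , j∈ })
           ((a ≟ 0) ×-dec residue? 0 (s≤s z≤n) b ×-dec Any.any? (c ≟_) (1 ∷ 2 ∷ []))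
  ⊎-dec map′ (λ { (refl , (k , refl) , j∈) → k , c , j∈ , refl })
           (λ { (k , j , j∈ , refl) → refl , (k , refl) , j∈ })
           ((a ≟ 1) ×-dec residue? 1 (s≤s (s≤s z≤n)) b ×-dec Any.any? (c ≟_) (0 ∷ 1 ∷ []))
  ⊎-dec map′ (λ { (refl , (k , refl) , refl) → k , refl })
           (λ { (k , refl) → refl , (k , refl) , refl })
           ((a ≟ 2) ×-dec residue? 2 ≤-refl b ×-dec (c ≟ 0))
  ⊎-dec Any.any? (t ≟ₜ_) SporadicException

PCensus : Pred Triple 0ℓ
PCensus (a , b , c) = PCondition a b c

-- Residues are taken first because `2 * (3 + b)` does not compute to `6 + 2 * b` for a variable
-- `b`, which would hide the period in `b`.
a+2b%3 : ∀ a b → (a + 2 * b) % 3 ≡ (a % 3 + 2 * (b % 3) % 3) % 3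
a+2b%3 a b = ≡-trans (%-distribˡ-+ a (2 * b) 3)
                     (cong (λ m → (a % 3 + m) % 3) (%-distribˡ-* 2 b 3))

pCensus? : Decidable PCensus
pCensus? t@(a , b , c) =
      ((a ≟ 0) ×-dec (c ≟ 0))
  ⊎-dec Any.any? (t ≟ₜ_) SporadicP
  ⊎-dec (map′ (≡-trans (a+2b%3 a b)) (≡-trans (sym (a+2b%3 a b)))
             ((a % 3 + 2 * (b % 3) % 3) % 3 ≟ 0)
        ×-dec ¬? (exception? t))

-- The finite verification

-- The period is `suc k`, positive so that the recursion descends. The base covers the preperiod and
-- one full period; any larger `n` drops by one period to a value still at least `m`.
eventually-periodic : ∀ m k {P : ℕ → Set} → (∀ {n} → n < suc k + m → P n) →
  (∀ n → P (m + n) → P (suc k + m + n)) → ∀ n → P n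
eventually-periodic m k {P} base step = <-rec P λ n rec → case n rec (n <? suc k + m)
  where
  case : ∀ n → (∀ {i} → i < n → P i) → Dec (n < suc k + m) → P n
  case n rec (yes n<) = base n<
  case n rec (no n≮) with j , refl ← m≤n⇒∃[o]m+o≡n (≮⇒≥ n≮) =
    step j (rec (+-monoˡ-< j (s≤s (m≤n+m m k))))

-- An equation of Booleans rather than an equivalence: beyond the thresholds, a shift by the period
-- leaves it the same by computation, so each induction step is just its hypothesis.
Consistent : ℕ → ℕ → ℕ → Set
Consistent a b c = does (pCensus? (a , b , c)) ≡ not (does (optionIn? pCensus? (a , b , c)))

consistent? : ∀ a b c → Dec (Consistent a b c)
consistent? a b c = _ Bool.≟ _

does-not⇒⇔ : ∀ {A B : Set} (A? : Dec A) (B? : Dec B) → does A? ≡ not (does B?) → A ⇔ (¬ B)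
does-not⇒⇔ (yes a) (no ¬b) _ = mk⇔ (const ¬b) (const a)
does-not⇒⇔ (no ¬a) (yes b) _ = mk⇔ (λ a _ → ¬a a) (λ ¬b → contradiction b ¬b)

-- The coordinates of the non-periodic part of `PCondition` are at most 3, 2 and
-- 5, and a move lowers a coordinate by at most 2: hence the thresholds 6, 5, 8.
consistent : ∀ a b c → Consistent a b c
consistent = eventually-periodic 6 2
  (λ a< → eventually-periodic 5 2
    (λ b< → eventually-periodic 8 0 (check a< b<) (λ _ ih → ih))
    (λ _ ih → ih))
  (λ _ ih b c → ih b c)
  where
  check : ∀ {a} → a < 9 → ∀ {b} → b < 8 → ∀ {c} → c < 9 → Consistent a b c
  -- All 9 * 8 * 9 = 648 base censuses are decided by evaluation; `_` is the trivial proof that the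
  -- outcome is true.
  check = toWitness
    {a? = allUpTo? (λ a → allUpTo? (λ b → allUpTo? (λ c → consistent? a b c) 9) 8) 9} _

pCensus⇔noOption : ∀ t → PCensus t ⇔ (¬ OptionIn PCensus t)
pCensus⇔noOption t@(a , b , c) = does-not⇒⇔ (pCensus? t) (optionIn? pCensus? t) (consistent a b c)

-- Strategies

Outcome : Position → Set
Outcome p = (PCensus (census p) → IsP p) × (¬ PCensus (census p) → IsN p)

-- Induction on the number of tokens. The two halves are proved together, since a move passes from
-- each to the other.
outcome : ∀ p → All (_≤ 3) p → Acc _<_ (sum p) → Outcome p
outcome p p≤3 (acc rec) =
    (λ c → isP λ q m → proj₂ (ih m) (to c ∘ move⇒optionIn PCensus p≤3 m))
  -- Decidability removes the double negation and yields a concrete option to move to.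
  , (λ ¬c → let o         = decidable-stable (optionIn? pCensus? (census p)) (¬c ∘ from)
                q , m , c = optionIn⇒move PCensus p o
            in isN q m (proj₁ (ih m) c))
  where
  open Equivalence (pCensus⇔noOption (census p))
  ih : ∀ {q} → Move p q → Outcome q
  ih m = outcome _ (move-bounded m p≤3) (rec (move-sum m))

-- The two strategies are played against each other, exchanging roles at every move; the derivations
-- are well founded, so this ends.
IsP∧IsN⇒⊥ : ∀ {p} → IsP p → ¬ IsN p
IsP∧IsN⇒⊥ (isP f) (isN q m w) = IsP∧IsN⇒⊥ w (f q m)

lemma3p3 : ∀ (a₁ a₂ a₃ : ℕ) (p : Position) → All (_≤ 3) p →
    #piles 1 p ≡ a₁ → #piles 2 p ≡ a₂ → #piles 3 p ≡ a₃ →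
    IsP p ⇔ PCondition a₁ a₂ a₃
lemma3p3 _ _ _ p p≤3 refl refl refl = mk⇔ to (proj₁ result)
  where
  result : Outcome p
  result = outcome p p≤3 (<-wellFounded (sum p))
  to : IsP p → PCensus (census p)
  to w = decidable-stable (pCensus? (census p)) λ ¬c → IsP∧IsN⇒⊥ w (proj₂ result ¬c)
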